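{- $(\mathrm{L}+(\mathrm{CS}))$-grammars recognize all permutations of regular languages: for every finite alphabet $\Sigma$ and every regular language $L\subseteq\Sigma^+$ (i.e. not containing the empty word), there exists an $(\mathrm{L}+(\mathrm{CS}))$-grammar $G$ over $\Sigma$ such that $L(G)=\mathrm{PERM}(L)$, where $\mathrm{PERM}(L)=\{a_{\sigma(1)}\dots a_{\sigma(n)}\mid a_1\dots a_n\in L,\ \sigma\in S_n\}$.
   Context: Types are built from primitive types (elements of a fixed infinite set $Pr$) using the binary connectives $\backslash$, $/$, $\cdot$. A sequent is $A_1,\dots,A_n\to B$ with $n\ge 1$ and $A_i,B$ types. Capital Latin letters denote types, $\Gamma,\Delta$ finite (possibly empty) sequences of types, $\Pi,\Psi$ nonempty finite sequences of types. The calculus $\mathrm{L}+(\mathrm{CS})$ is obtained from the Lambek calculus by adding the structural rule $(\mathrm{CS})$; its axioms and rules are: - $(\mathrm{Ax})$: $A\to A$. - $(\backslash\to)$: from $\Gamma,B,\Delta\to C$ and $\Pi\to A$ infer $\Gamma,\Pi,A\backslash B,\Delta\to C$. - $(\to\backslash)$: from $A,\Pi\to B$ infer $\Pi\to A\backslash B$. - $(/\to)$: from $\Gamma,B,\Delta\to C$ and $\Pi\to A$ infer $\Gamma,B/A,\Pi,\Delta\to C$. - $(\to/)$: from $\Pi,A\to B$ infer $\Pi\to B/A$. - $(\cdot\to)$: from $\Gamma,A,B,\Delta\to C$ infer $\Gamma,A\cdot B,\Delta\to C$. - $(\to\cdot)$: from $\Pi\to A$ and $\Psi\to B$ infer $\Pi,\Psi\to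 A\cdot B$. - $(\mathrm{cut})$: from $\Pi\to A$ and $\Gamma,A,\Delta\to B$ infer $\Gamma,\Pi,\Delta\to B$. - $(\mathrm{CS})$: from $\Pi,\Psi\to A$ infer $\Psi,\Pi\to A$. An $(\mathrm{L}+(\mathrm{CS}))$-grammar is a triple $G=\langle\Sigma,T,\triangleright\rangle$ where $\Sigma$ is a finite alphabet, $T$ is a distinguished type, and $\triangleright$ is a finite binary relation between $\Sigma$ and the set of types. The language recognized by $G$ is $L(G)=\{a_1\dots a_n\in\Sigma^+\mid \exists\text{ types }T_1,\dots,T_n:\ a_i\triangleright T_i\text{ for } i=1,\dots,n,\text{ and } T_1,\dots,T_n\to T\text{ is derivable in }\mathrm{L}+(\mathrm{CS})\}$. -}

module Defs where

open import Data.Fin.Base using (Fin)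
open import Data.Fin.Permutation using (Permutation′; _⟨$⟩ʳ_)
open import Data.Fin.Subset using (Subset) renaming (_∈_ to _∈ₛ_)
open import Data.List.Base using (List; _∷_; foldl; length; lookup; tabulate)
open import Data.List.Membership.Propositional using () renaming (_∈_ to _∈ₗ_)
open import Data.List.NonEmpty.Base
  using (List⁺; _∷_; [_]; toList; _∷⁺_; _⁺∷ʳ_; _++⁺_; _⁺++⁺_; _⁺++_)
open import Data.List.Relation.Binary.Pointwise.Base using (Pointwise)
open import Data.Nat.Base using (ℕ)
open import Data.Product.Base using (∃; ∃-syntax; _×_; _,_)
open import Level using (Level; 0ℓ; suc)
open import Relation.Binary.PropositionalEquality.Core using (_≡_)
open import Relation.Unary using (Pred; _∈_; _≐_)

private
  variable
    ℓ : Level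

infixr 7 _∖_
infixl 7 _/_
infixl 8 _·_

data Type (Pr : Set) : Set where
  prim        : Pr → Type Pr
  _∖_ _/_ _·_ : Type Pr → Type Pr → Type Pr

infix 3 _⊢_

-- Antecedents are nonempty by construction: Π and Ψ range over List⁺,
-- Γ and Δ over List.
data _⊢_ {Pr : Set} : List⁺ (Type Pr) → Type Pr → Set where
  ax  : ∀ {A} → [ A ] ⊢ A
  ∖L  : ∀ {Γ Π Δ A B C} → Γ ++⁺ (B ∷ Δ) ⊢ C → Π ⊢ A →
        Γ ++⁺ (Π ⁺++⁺ (A ∖ B ∷ Δ)) ⊢ C
  ∖R  : ∀ {Π A B} → A ∷⁺ Π ⊢ B → Π ⊢ A ∖ B
  /L  : ∀ {Γ Π Δ A B C} → Γ ++⁺ (B ∷ Δ) ⊢ C → Π ⊢ A →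
        Γ ++⁺ (B / A ∷⁺ Π ⁺++ Δ) ⊢ C
  /R  : ∀ {Π A B} → Π ⁺∷ʳ A ⊢ B → Π ⊢ B / A
  ·L  : ∀ {Γ Δ A B C} → Γ ++⁺ (A ∷ B ∷ Δ) ⊢ C → Γ ++⁺ (A · B ∷ Δ) ⊢ C
  ·R  : ∀ {Π Ψ A B} → Π ⊢ A → Ψ ⊢ B → Π ⁺++⁺ Ψ ⊢ A · B
  cut : ∀ {Γ Π Δ A B} → Π ⊢ A → Γ ++⁺ (A ∷ Δ) ⊢ B →
        Γ ++⁺ (Π ⁺++ Δ) ⊢ B
  cs  : ∀ {Π Ψ A} → Π ⁺++⁺ Ψ ⊢ A → Ψ ⁺++⁺ Π ⊢ A

Language : Set → (ℓ : Level) → Set (suc ℓ)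
Language Σ ℓ = Pred (List Σ) ℓ

record Grammar (Pr Σ : Set) : Set where
  field
    target  : Type Pr
    lexicon : List (Σ × Type Pr)

  _▷_ : Σ → Type Pr → Set
  a ▷ A = (a , A) ∈ₗ lexicon

  recognized : Language Σ 0ℓ
  recognized w = ∃[ Ts ] Pointwise _▷_ w (toList Ts) × Ts ⊢ target

record DFA (Σ : Set) : Set where
  field
    states : ℕ
    start  : Fin states
    δ      : Fin states → Σ → Fin states
    final  : Subset states

  accepted : Language Σ 0ℓ
  accepted w = foldl δ start w ∈ₛ final

Regular : {Σ : Set} → Language Σ ℓ → Set ℓ
Regular {Σ = Σ} L = ∃[ M ] L ≐ DFA.accepted {Σ} M

PERM : {Σ : Set} → Language Σ ℓ → Language Σ ℓ
PERM L w = ∃ λ u → u ∈ L × ∃ λ (σ : Permutation′ (length u)) →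
  w ≡ tabulate (λ i → lookup u (σ ⟨$⟩ʳ i))

{-# OPTIONS --safe #-}

-- In the presence of cut, (CS) yields full exchange: it gives B, A ⊢ A · B, and
-- cutting this against ·L swaps any two adjacent antecedents.  Hence a grammar
-- with a type  prim (δ q a) ∖ prim q  for each transition, and a type  prim q
-- for each transition into a final state, derives all permutations of accepted
-- words.  Conversely, the calculus is sound for the residuated algebra of
-- ↭-closed predicates on words.  Interpreting  prim q  as "some permutation
-- is accepted from q" puts each letter in the denotation of each of its types,
-- so derivability of the start state makes the word a permutation of an
-- accepted one; no cut elimination is needed.
module Submission where

open import Defs
import Algebra.Properties.CommutativeMonoid.Sum as Sum
open import Data.Fin.Base using (Fin; zero; suc; toℕ)
open import Data.Fin.Permutation using (Permutation; Permutation′; _⟨$⟩ʳ_)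
open import Data.Fin.Properties using (toℕ-injective)
open import Data.Fin.Subset using () renaming (_∈_ to _∈ₛ_)
open import Data.Fin.Subset.Properties using (_∈?_)
open import Data.List.Base
  using (List; []; _∷_; _++_; allFin; cartesianProduct; filter; foldl; length; lookup; map;
         tabulate)
open import Data.List.Membership.Propositional using () renaming (_∈_ to _∈ₗ_)
open import Data.List.Membership.Propositional.Properties
  using (∈-allFin; ∈-cartesianProduct⁺; ∈-filter⁺; ∈-filter⁻; ∈-map⁺; ∈-map⁻;
         ∈-++⁺ˡ; ∈-++⁺ʳ; ∈-++⁻)
open import Data.List.NonEmpty.Base
  using (List⁺; _∷_; [_]; toList; _++⁺_)
open import Data.List.Properties using (++-assoc; tabulate-lookup; tabulate-cong)
open import Data.List.Relation.Binary.Permutation.Propositional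
  using (_↭_; refl; prep; swap; trans; ↭-reflexive; ↭-refl; ↭-sym; ↭-trans; ↭⇒↭ₛ)
open import Data.List.Relation.Binary.Permutation.Propositional.Properties
  using (++⁺ˡ; ++⁺ʳ; ++-comm; ++-commutativeMonoid; ↭-length)
import Data.List.Relation.Binary.Permutation.Homogeneous as Homogeneous
import Data.List.Relation.Binary.Permutation.Setoid.Properties as Permutationₛ
import Data.List.Relation.Binary.Pointwise.Base as Pointwise
open Pointwise using (Pointwise; []; _∷_)
open import Data.Nat.Base using (ℕ)
open import Data.Product.Base using (_×_; _,_; ∃; ∃-syntax; ∃₂; proj₁; proj₂)
open import Data.Sum.Base using (inj₁; inj₂)
open import Function.Base using (_∘_; id)
open import Function.Bundles using (_↣_; _↔_; Injection; Inverse)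
open import Level using (Level; 0ℓ)
open import Relation.Binary.PropositionalEquality
  using (_≡_; _≢_; _≗_; refl; sym; cong; subst; setoid)
  renaming (trans to ≡-trans)
open import Relation.Nullary.Decidable.Core using (Dec)
open import Relation.Nullary.Negation using (contradiction)
open import Relation.Unary using (_∈_; _∉_; _⊆_; _≐_)

-- Permutations of lists and of their indices

private
  variable
    a b ℓ : Level
    X : Set a
    Y : Set b

-- Up to `↭`, lists under `++` form a commutative monoid in which a tabulated list is the sum of its
-- singletons, and finite sums are invariant under reindexing.
tabulate-permute : ∀ {n} (f : Fin n → X) (π : Permutation′ n) →
                   tabulate f ↭ tabulate (f ∘ (π ⟨$⟩ʳ_))
tabulate-permute {X = X} f π =
  ↭-trans (↭-reflexive (sym (sum-[_] f)))
    (↭-trans (sum-permute (λ i → f i ∷ []) π) (↭-reflexive (sum-[_] (f ∘ (π ⟨$⟩ʳ_)))))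
  where
  open Sum (++-commutativeMonoid {A = X}) using (sum; sum-permute)
  sum-[_] : ∀ {n} (g : Fin n → X) → sum (λ i → g i ∷ []) ≡ tabulate g
  sum-[_] {ℕ.zero}  g = refl
  sum-[_] {ℕ.suc n} g = cong (g zero ∷_) (sum-[_] (g ∘ suc))

↭⇒tabulate : {xs ys : List X} → xs ↭ ys →
             ∃ λ (σ : Permutation′ (length ys)) → xs ≡ tabulate (λ i → lookup ys (σ ⟨$⟩ʳ i))
↭⇒tabulate {X = X} {xs} {ys} xs↭ys =
  let σ , eq = square (↭-length xs↭ys) (lookup xs) (Homogeneous.onIndices xs↭ₛys)
                 (Permutationₛ.onIndices-lookup (setoid X) xs↭ₛys)
  in  σ , ≡-trans (sym (tabulate-lookup xs)) eq
  where
  xs↭ₛys = ↭⇒↭ₛ xs↭ys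
  -- With a variable in place of `length xs`, the equality of lengths can be matched, and the
  -- bijection between two index sets becomes a permutation of one.
  square : ∀ {n} → n ≡ length ys → (f : Fin n → X) (π : Permutation n (length ys)) →
           f ≗ lookup ys ∘ (π ⟨$⟩ʳ_) →
           ∃ λ (σ : Permutation′ (length ys)) → tabulate f ≡ tabulate (lookup ys ∘ (σ ⟨$⟩ʳ_))
  square refl f π eq = π , tabulate-cong eq

PERM⁺ : {L : Language X ℓ} {w u : List X} → u ∈ L → w ↭ u → w ∈ PERM L
PERM⁺ u∈L w↭u = _ , u∈L , ↭⇒tabulate w↭u

PERM⁻ : {L : Language X ℓ} {w : List X} → w ∈ PERM L → ∃[ u ] u ∈ L × w ↭ u
PERM⁻ (u , u∈L , σ , refl) =
  u , u∈L , ↭-sym (↭-trans (↭-reflexive (sym (tabulate-lookup u)))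
                            (tabulate-permute (lookup u) σ))

Pointwise-↭ : {R : X → Y → Set ℓ} {us ws : List X} {ys : List Y} → us ↭ ws →
              Pointwise R us ys → ∃[ zs ] ys ↭ zs × Pointwise R ws zs
Pointwise-↭ refl         rs           = _ , refl , rs
Pointwise-↭ (prep _ p)   (r ∷ rs)     =
  let _ , q , rs′ = Pointwise-↭ p rs in _ , prep _ q , r ∷ rs′
Pointwise-↭ (swap _ _ p) (r ∷ s ∷ rs) =
  let _ , q , rs′ = Pointwise-↭ p rs in _ , swap _ _ q , s ∷ r ∷ rs′
Pointwise-↭ (trans p p′) rs           =
  let _ , q , rs′ = Pointwise-↭ p rs
      _ , q′ , rs″ = Pointwise-↭ p′ rs′
  in  _ , trans q q′ , rs″

toList-++⁺ : (xs : List X) (ys : List⁺ X) → toList (xs ++⁺ ys) ≡ xs ++ toList ys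
toList-++⁺ []       ys = refl
toList-++⁺ (x ∷ xs) ys = cong (x ∷_) (toList-++⁺ xs ys)

toList-injective : {xs ys : List⁺ X} → toList xs ≡ toList ys → xs ≡ ys
toList-injective refl = refl

-- Exchange in the calculus

module _ {Pr : Set} where

  private
    variable
      A B C : Type Pr
      Γ Δ : List (Type Pr)

  -- Permutations act on plain lists while sequents have nonempty antecedents; the equation mediates
  -- between the two.
  Derivable : List (Type Pr) → Type Pr → Set
  Derivable Γ A = ∃[ Π ] toList Π ≡ Γ × Π ⊢ A

  derivable : ∀ Γ {Π} → Γ ++⁺ Π ⊢ A → Derivable (Γ ++ toList Π) A
  derivable Γ {Π} d = Γ ++⁺ Π , toList-++⁺ Γ Π , d

  derivation : ∀ Γ {Π} → Derivable (Γ ++ toList Π) A → Γ ++⁺ Π ⊢ A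
  derivation {A} Γ {Π} (Ψ , eq , d) =
    subst (_⊢ A) (toList-injective (≡-trans eq (sym (toList-++⁺ Γ Π)))) d

  ⊢-swap : ∀ Γ → Γ ++⁺ (A ∷ B ∷ Δ) ⊢ C → Γ ++⁺ (B ∷ A ∷ Δ) ⊢ C
  ⊢-swap {A} {B} Γ d =
    cut {Γ = Γ} {Π = B ∷ A ∷ []} (cs {Π = [ A ]} {Ψ = [ B ]} (·R ax ax)) (·L {Γ = Γ} d)

  -- A derivation cannot be restricted to a tail of its antecedent, so the heads passed by `prep`
  -- and `swap` are collected in the prefix `Θ`.
  exchange : ∀ Θ → Γ ↭ Δ → Derivable (Θ ++ Γ) C → Derivable (Θ ++ Δ) C
  exchange Θ refl         d = d
  exchange Θ (trans p q)  d = exchange Θ q (exchange Θ p d)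
  exchange {C = C} Θ (prep {xs} {ys} x p) d =
    subst (λ Γ → Derivable Γ C) (++-assoc Θ (x ∷ []) ys)
      (exchange (Θ ++ x ∷ []) p
        (subst (λ Γ → Derivable Γ C) (sym (++-assoc Θ (x ∷ []) xs)) d))
  exchange {C = C} Θ (swap {xs} {ys} x y p) d =
    subst (λ Γ → Derivable Γ C) (++-assoc Θ (y ∷ x ∷ []) ys)
      (exchange (Θ ++ y ∷ x ∷ []) p
        (subst (λ Γ → Derivable Γ C) (sym (++-assoc Θ (y ∷ x ∷ []) xs))
          (derivable Θ (⊢-swap Θ (derivation Θ d)))))

-- The residuated algebra of permutation-closed languages

module _ {S : Set} where

  infixr 6 _✶_
  infixr 5 _─✶_

  -- A product and its residual. The product is commutative, so on permutation-closed languages the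
  -- left and right residuals agree and one arrow can interpret both divisions.
  _✶_ _─✶_ : Language S 0ℓ → Language S 0ℓ → Language S 0ℓ
  (P ✶ Q) w  = ∃₂ λ u v → P u × Q v × u ++ v ↭ w
  (P ─✶ Q) w = ∀ {u} → P u → Q (u ++ w)

  ↭-Closed : Language S 0ℓ → Set
  ↭-Closed P = ∀ {u v} → u ↭ v → P u → P v

  private
    variable
      P Q R P′ Q′ : Language S 0ℓ

  ✶-closed : ↭-Closed (P ✶ Q)
  ✶-closed w↭w′ (u , v , p , q , r) = u , v , p , q , ↭-trans r w↭w′

  ─✶-closed : ↭-Closed Q → ↭-Closed (P ─✶ Q)
  ─✶-closed Q-closed w↭w′ f p = Q-closed (++⁺ˡ _ w↭w′) (f p)

  ✶-mono : P ⊆ P′ → Q ⊆ Q′ → P ✶ Q ⊆ P′ ✶ Q′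
  ✶-mono f g (u , v , p , q , r) = u , v , f p , g q , r

  ✶-comm : P ✶ Q ⊆ Q ✶ P
  ✶-comm (u , v , p , q , r) = v , u , q , p , ↭-trans (++-comm v u) r

  ✶-assocˡ : P ✶ (Q ✶ R) ⊆ (P ✶ Q) ✶ R
  ✶-assocˡ (u , _ , p , (v , x , q , r , s) , t) =
    u ++ v , x , (u , v , p , q , ↭-refl) , r ,
    ↭-trans (↭-reflexive (++-assoc u v x)) (↭-trans (++⁺ˡ u s) t)

  ✶-assocʳ : (P ✶ Q) ✶ R ⊆ P ✶ (Q ✶ R)
  ✶-assocʳ (_ , x , (u , v , p , q , s) , r , t) =
    u , v ++ x , p , (v , x , q , r , ↭-refl) ,
    ↭-trans (↭-reflexive (sym (++-assoc u v x))) (↭-trans (++⁺ʳ x s) t)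

  ─✶-eval : ↭-Closed Q → P ✶ (P ─✶ Q) ⊆ Q
  ─✶-eval Q-closed (u , v , p , f , r) = Q-closed r (f p)

  ✶-identityˡ : ↭-Closed Q → (_↭ []) ✶ Q ⊆ Q
  ✶-identityˡ Q-closed (u , v , u↭[] , q , r) = Q-closed (↭-trans (++⁺ʳ v (↭-sym u↭[])) r) q

  ✶-identityʳ : ↭-Closed Q → Q ✶ (_↭ []) ⊆ Q
  ✶-identityʳ Q-closed = ✶-identityˡ Q-closed ∘ ✶-comm

-- Soundness of the calculus

module Semantics {Pr S : Set} (V : Pr → Language S 0ℓ) (V-closed : ∀ p → ↭-Closed (V p)) where

  private
    variable
      A C : Type Pr

  ⟦_⟧ : Type Pr → Language S 0ℓ
  ⟦ prim p ⟧ = V p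
  ⟦ A ∖ B  ⟧ = ⟦ A ⟧ ─✶ ⟦ B ⟧
  ⟦ B / A  ⟧ = ⟦ A ⟧ ─✶ ⟦ B ⟧
  ⟦ A · B  ⟧ = ⟦ A ⟧ ✶ ⟦ B ⟧

  ⟦_⟧* : List (Type Pr) → Language S 0ℓ
  ⟦ []    ⟧* = _↭ []
  ⟦ A ∷ Γ ⟧* = ⟦ A ⟧ ✶ ⟦ Γ ⟧*

  ⟦⟧-closed : ∀ A → ↭-Closed ⟦ A ⟧
  ⟦⟧-closed (prim p) = V-closed p
  ⟦⟧-closed (A ∖ B)  = ─✶-closed {P = ⟦ A ⟧} (⟦⟧-closed B)
  ⟦⟧-closed (B / A)  = ─✶-closed {P = ⟦ A ⟧} (⟦⟧-closed B)
  ⟦⟧-closed (A · B)  = ✶-closed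

  ⟦⟧*-closed : ∀ Γ → ↭-Closed ⟦ Γ ⟧*
  ⟦⟧*-closed []      u↭v u↭[] = ↭-trans (↭-sym u↭v) u↭[]
  ⟦⟧*-closed (A ∷ Γ) = ✶-closed

  split : ∀ Γ {Δ} → ⟦ Γ ++ Δ ⟧* ⊆ ⟦ Γ ⟧* ✶ ⟦ Δ ⟧*
  split []      m = [] , _ , ↭-refl , m , ↭-refl
  split (A ∷ Γ) m = ✶-assocˡ (✶-mono {P = ⟦ A ⟧} id (split Γ) m)

  join : ∀ Γ {Δ} → ⟦ Γ ⟧* ✶ ⟦ Δ ⟧* ⊆ ⟦ Γ ++ Δ ⟧*
  join []      {Δ} m = ✶-identityˡ (⟦⟧*-closed Δ) m
  join (A ∷ Γ) m = ✶-mono {P = ⟦ A ⟧} id (join Γ) (✶-assocʳ {P = ⟦ A ⟧} m)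

  replace : ∀ Γ {Π Ψ} → ⟦ toList Π ⟧* ⊆ ⟦ toList Ψ ⟧* →
            ⟦ toList (Γ ++⁺ Π) ⟧* ⊆ ⟦ toList (Γ ++⁺ Ψ) ⟧*
  replace Γ {Π} {Ψ} f {w} m =
    subst (λ Δ → ⟦ Δ ⟧* w) (sym (toList-++⁺ Γ Ψ))
      (join Γ (✶-mono id f (split Γ (subst (λ Δ → ⟦ Δ ⟧* w) (toList-++⁺ Γ Π) m))))

  singleton : ⟦ A ⟧ ⊆ ⟦ A ∷ [] ⟧*
  singleton a = _ , [] , a , ↭-refl , ++-comm _ []

  -- Each rule becomes a law of the algebra: the left rules for the divisions are evaluation after
  -- regrouping, `·L` is associativity, `cut` is monotonicity and `cs` is commutativity.
  sound : ∀ {Π} → Π ⊢ A → ⟦ toList Π ⟧* ⊆ ⟦ A ⟧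
  sound {A} ax m = ✶-identityʳ (⟦⟧-closed A) m
  sound (∖L {Γ} {Π} {Δ} {A} {B} d e) m = sound d
    (replace Γ (✶-mono {Q = ⟦ Δ ⟧*} (─✶-eval (⟦⟧-closed B) ∘ ✶-mono {Q = ⟦ A ∖ B ⟧} (sound e) id) id
                ∘ ✶-assocˡ {Q = ⟦ A ∖ B ⟧} {R = ⟦ Δ ⟧*} ∘ split (toList Π)) m)
  sound (∖R d) m a = sound d (_ , _ , a , m , ↭-refl)
  sound (/L {Γ} {Π} {Δ} {A} {B} d e) m = sound d
    (replace Γ (✶-mono {Q = ⟦ Δ ⟧*}
                  (─✶-eval (⟦⟧-closed B) ∘ ✶-mono {Q = ⟦ B / A ⟧} (sound e) id ∘ ✶-comm {P = ⟦ B / A ⟧}) id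
                ∘ ✶-assocˡ {P = ⟦ B / A ⟧} {R = ⟦ Δ ⟧*} ∘ ✶-mono {P = ⟦ B / A ⟧} id (split (toList Π))) m)
  -- The residual puts its argument in front, but the premise has `A` last, so the two factors trade
  -- places before they are joined.
  sound (/R {Π} {A} d) m a = sound d (join (toList Π) (✶-comm (_ , _ , singleton {A} a , m , ↭-refl)))
  sound (·L {Γ} {Δ} {A} {B} d) m =
    sound d (replace Γ (✶-assocʳ {P = ⟦ A ⟧} {Q = ⟦ B ⟧} {R = ⟦ Δ ⟧*}) m)
  sound (·R {Π} d e) m = ✶-mono (sound d) (sound e) (split (toList Π) m)
  sound (cut {Γ} {Π} {Δ} d e) m =
    sound e (replace Γ (✶-mono {Q = ⟦ Δ ⟧*} (sound d) id ∘ split (toList Π)) m)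
  sound (cs {Π} {Ψ} d) m = sound d (join (toList Π) (✶-comm (split (toList Ψ) m)))

  tile : ∀ {w Γ} → Pointwise (λ a A → ⟦ A ⟧ (a ∷ [])) w Γ → ⟦ Γ ⟧* w
  tile []       = ↭-refl
  tile (a ∷ as) = _ , _ , a , tile as , ↭-refl

-- The grammar of an automaton and its correctness

module _ {Pr S : Set} (ι : ℕ ↣ Pr) (letters : List S) (complete : ∀ a → a ∈ₗ letters)
         (M : DFA S) where

  open DFA M

  state : Fin states → Pr
  state = Injection.to ι ∘ toℕ

  state-injective : ∀ {q r} → state q ≡ state r → q ≡ r
  state-injective = toℕ-injective ∘ Injection.injective ι

  -- Antecedents are nonempty, so a run cannot be closed by an empty remainder: `stop` is meant for
  -- the last letter, on a transition that enters a final state, and `step` for the earlier ones.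
  step stop : Fin states × S → S × Type Pr
  step (q , a) = a , prim (state (δ q a)) ∖ prim (state q)
  stop (q , a) = a , prim (state q)

  transitions : List (Fin states × S)
  transitions = cartesianProduct (allFin states) letters

  final? : ∀ t → Dec (δ (proj₁ t) (proj₂ t) ∈ₛ final)
  final? t = δ (proj₁ t) (proj₂ t) ∈? final

  grammar : Grammar Pr S
  grammar = record
    { target  = prim (state start)
    ; lexicon = map step transitions ++ map stop (filter final? transitions)
    }

  open Grammar grammar

  ∈-transitions : ∀ t → t ∈ₗ transitions
  ∈-transitions (q , a) = ∈-cartesianProduct⁺ (∈-allFin q) (complete a)

  step-▷ : ∀ q a → a ▷ (prim (state (δ q a)) ∖ prim (state q))
  step-▷ q a = ∈-++⁺ˡ (∈-map⁺ step (∈-transitions (q , a)))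

  stop-▷ : ∀ q a → δ q a ∈ₛ final → a ▷ prim (state q)
  stop-▷ q a f =
    ∈-++⁺ʳ (map step transitions) (∈-map⁺ stop (∈-filter⁺ final? (∈-transitions (q , a)) f))

  path : ∀ q a w → foldl δ q (a ∷ w) ∈ₛ final →
         ∃[ Ts ] Pointwise _▷_ (a ∷ w) (toList Ts) × Ts ⊢ prim (state q)
  path q a []      f = [ prim (state q) ] , stop-▷ q a f ∷ [] , ax
  path q a (b ∷ w) f =
    let Ts , ts , d = path (δ q a) b w f
    -- The left rule places the types `Ts` of the remaining word before the type of the first
    -- letter; `cs` rotates them behind it.
    in  _ , step-▷ q a ∷ ts , cs {Π = Ts} (∖L {Γ = []} {Δ = []} ax d)

  recognized⁺ : ∀ {w u} → u ∈ accepted → u ≢ [] → w ↭ u → w ∈ recognized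
  recognized⁺ {u = []}    _ ne _ = contradiction refl ne
  recognized⁺ {u = a ∷ u} f _  p with path start a u f
  ... | Ts , ts , d with Pointwise-↭ (↭-sym p) ts
  -- The types have moved along with their letters, and the derivation is now reordered by the same
  -- permutation.
  ... | _ , q , ts′ with exchange [] q (Ts , refl , d)
  ... | Ts′ , refl , d′ = Ts′ , ts′ , d′

  -- Quantifying over the states coded by `p` avoids decoding `p`. By injectivity of `state` the
  -- condition at `state q` concerns `q` alone; a primitive type coding no state denotes all words.
  V : Pr → Language S 0ℓ
  V p w = ∀ q → p ≡ state q → ∃[ u ] w ↭ u × foldl δ q u ∈ₛ final

  V-closed : ∀ p → ↭-Closed (V p)
  V-closed p u↭v f q eq = let x , r , acc = f q eq in x , ↭-trans (↭-sym u↭v) r , acc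

  open Semantics V V-closed

  step-sound : ∀ q a → ⟦ prim (state (δ q a)) ∖ prim (state q) ⟧ (a ∷ [])
  step-sound q a {u} f r eq with refl ← state-injective eq =
    let x , p , acc = f (δ q a) refl
    -- The residual leaves the letter behind `u`, whereas the automaton reads it first, so it is
    -- moved to the front.
    in  a ∷ x , ↭-trans (++-comm u (a ∷ [])) (prep a p) , acc

  stop-sound : ∀ q a → δ q a ∈ₛ final → ⟦ prim (state q) ⟧ (a ∷ [])
  stop-sound q a f r eq with refl ← state-injective eq = a ∷ [] , ↭-refl , f

  ▷-sound : ∀ {a A} → a ▷ A → ⟦ A ⟧ (a ∷ [])
  ▷-sound a▷A with ∈-++⁻ (map step transitions) a▷A
  ... | inj₁ i with (q , a) , _ , refl ← ∈-map⁻ step i = step-sound q a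
  ... | inj₂ i with (q , a) , j , refl ← ∈-map⁻ stop i =
    stop-sound q a (proj₂ (∈-filter⁻ final? {xs = transitions} j))

  recognized⁻ : ∀ {w} → w ∈ recognized → ∃[ u ] w ↭ u × u ∈ accepted
  recognized⁻ (Ts , ts , d) = sound d (tile (Pointwise.map ▷-sound ts)) start refl

theorem7 : (Pr : Set) → ℕ ↣ Pr →
    (Σ : Set) (k : ℕ) → Σ ↔ Fin k →
    {ℓ : Level} (L : Language Σ ℓ) → Regular L → [] ∉ L →
    ∃[ G ] Grammar.recognized {Pr} {Σ} G ≐ PERM L
theorem7 Pr ι Σ k enum L (M , L⊆M , M⊆L) []∉L =
  grammar ι letters complete M ,
  (λ w∈G → let _ , p , acc = recognized⁻ ι letters complete M w∈G in PERM⁺ (M⊆L acc) p) ,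
  (λ w∈P → let _ , u∈L , p = PERM⁻ w∈P
           -- As `L` omits the empty word, the accepted word has a first letter from which its
           -- derivation can be built.
           in  recognized⁺ ι letters complete M (L⊆M u∈L) (λ u≡[] → []∉L (subst L u≡[] u∈L)) p)
  where
  letters : List Σ
  letters = map (Inverse.from enum) (allFin k)
  complete : ∀ a → a ∈ₗ letters
  complete a = subst (_∈ₗ letters) (Inverse.strictlyInverseʳ enum a)
                 (∈-map⁺ (Inverse.from enum) (∈-allFin (Inverse.to enum a)))
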